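{- There exist three real polynomials $p_1,p_2,p_3$ of degree at most $2$ with $\|p_i-p_j\|_\infty\le 2$ for all $i,j\in\{1,2,3\}$, such that for every real polynomial $q$ of degree at most $2$ there is some $i\in\{1,2,3\}$ with $\|q-p_i\|_\infty>1.09$.
   Context: $\|f\|_\infty=\sup_{x\in[-1,1]}|f(x)|$. -}

module Defs where

open import Data.Nat.Base as ℕ using (ℕ; zero; suc)
import Data.Nat.Properties as ℕ
import Data.Integer.Base as ℤ
import Data.Integer.Properties as ℤ
open import Data.Product using (Σ; ∃; _×_; _,_; proj₁; proj₂)
open import Data.Rational.Base
open import Data.Rational.Properties
open import Data.Rational.Solver using (module +-*-Solver)
import Data.Rational.Unnormalised.Base as ℚᵘ
import Data.Rational.Unnormalised.Properties as ℚᵘ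
open import Data.Sum using (inj₁; inj₂)
open import Data.Vec.Base using (Vec; []; _∷_; map; zipWith)
open import Relation.Binary.PropositionalEquality

open +-*-Solver using (solve; _:=_; _:+_; _:*_; _:-_; :-_)

------------------------------------------------------------------------
-- Rational inequalities

shift : ∀ {a b c d} → a ≤ b → b - a ≡ d - c → c ≤ d
shift {a} {b} {c} {d} a≤b eq =
  subst₂ _≤_ (solve 2 (λ a c → a :+ (c :- a) := c) refl a c)
    (trans (solve 3 (λ a b c → b :+ (c :- a) := c :+ (b :- a)) refl a b c)
      (trans (cong (c +_) eq) (solve 2 (λ c d → c :+ (d :- c) := d) refl c d)))
    (+-monoˡ-≤ (c - a) a≤b)

p≤p+q : ∀ {q} → 0ℚ ≤ q → ∀ p → p ≤ p + q
p≤p+q {q} h p = subst (_≤ p + q) (+-identityʳ p) (+-monoʳ-≤ p h)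

p≤∣p∣ : ∀ p → p ≤ ∣ p ∣
p≤∣p∣ p with ≤-total 0ℚ p
... | inj₁ 0≤p = ≤-reflexive (sym (0≤p⇒∣p∣≡p 0≤p))
... | inj₂ p≤0 = ≤-trans p≤0 (0≤∣p∣ p)

∣p∣≤q : ∀ {p q} → p ≤ q → - p ≤ q → ∣ p ∣ ≤ q
∣p∣≤q {p} p≤q -p≤q with ∣p∣≡p∨∣p∣≡-p p
... | inj₁ e = subst (_≤ _) (sym e) p≤q
... | inj₂ e = subst (_≤ _) (sym e) -p≤q

∣p-q∣-sym : ∀ p q → ∣ p - q ∣ ≡ ∣ q - p ∣
∣p-q∣-sym p q = trans (sym (∣-p∣≡∣p∣ (p - q)))
  (cong ∣_∣ (solve 2 (λ p q → :- (p :- q) := q :- p) refl p q))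

close : ∀ {p q ε} → p ≤ q + ε → q ≤ p + ε → ∣ p - q ∣ ≤ ε
close {p} {q} {ε} h k = ∣p∣≤q
  (shift h (solve 3 (λ p q e → (q :+ e) :- p := e :- (p :- q)) refl p q ε))
  (shift k (solve 3 (λ p q e → (p :+ e) :- q := e :- :- (p :- q)) refl p q ε))

closeˡ : ∀ {p q ε} → ∣ p - q ∣ ≤ ε → p ≤ q + ε
closeˡ {p} {q} {ε} h = shift (≤-trans (p≤∣p∣ (p - q)) h)
  (solve 3 (λ p q e → e :- (p :- q) := (q :+ e) :- p) refl p q ε)

closeʳ : ∀ {p q ε} → ∣ p - q ∣ ≤ ε → q ≤ p + ε
closeʳ {p} {q} h = closeˡ (subst (_≤ _) (∣p-q∣-sym p q) h)

∣∣-close : ∀ {p q ε} → ∣ p - q ∣ ≤ ε → ∣ ∣ p ∣ - ∣ q ∣ ∣ ≤ ε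
∣∣-close {p} {q} {ε} h = close (half p q h) (half q p (subst (_≤ ε) (∣p-q∣-sym p q) h))
  where
  half : ∀ p q → ∣ p - q ∣ ≤ ε → ∣ p ∣ ≤ ∣ q ∣ + ε
  half p q h = ≤-trans
    (subst (λ z → ∣ z ∣ ≤ ∣ q ∣ + ∣ p - q ∣)
      (solve 2 (λ p q → q :+ (p :- q) := p) refl p q) (∣p+q∣≤∣p∣+∣q∣ q (p - q)))
    (+-monoʳ-≤ ∣ q ∣ h)

∣-∣-triangle : ∀ p q r {δ ε} → ∣ p - q ∣ ≤ δ → ∣ q - r ∣ ≤ ε → ∣ p - r ∣ ≤ δ + ε
∣-∣-triangle p q r h k = ≤-trans
  (subst (λ z → ∣ z ∣ ≤ ∣ p - q ∣ + ∣ q - r ∣)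
    (solve 3 (λ p q r → (p :- q) :+ (q :- r) := p :- r) refl p q r)
    (∣p+q∣≤∣p∣+∣q∣ (p - q) (q - r)))
  (+-mono-≤ h k)

∣+-+∣ : ∀ p q p′ q′ {δ ε} → ∣ p - p′ ∣ ≤ δ → ∣ q - q′ ∣ ≤ ε →
        ∣ (p + q) - (p′ + q′) ∣ ≤ δ + ε
∣+-+∣ p q p′ q′ h k = ≤-trans
  (subst (λ z → ∣ z ∣ ≤ ∣ p - p′ ∣ + ∣ q - q′ ∣)
    (solve 4 (λ p q p′ q′ → (p :- p′) :+ (q :- q′) := (p :+ q) :- (p′ :+ q′)) refl p q p′ q′)
    (∣p+q∣≤∣p∣+∣q∣ (p - p′) (q - q′)))
  (+-mono-≤ h k)

*-mono-≤ : ∀ {p q r s} → 0ℚ ≤ p → 0ℚ ≤ r → p ≤ q → r ≤ s → p * r ≤ q * s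
*-mono-≤ {p} {q} {r} {s} 0≤p 0≤r p≤q r≤s = ≤-trans
  (*-monoʳ-≤-nonNeg r {{nonNegative 0≤r}} p≤q)
  (*-monoˡ-≤-nonNeg q {{nonNegative (≤-trans 0≤p p≤q)}} r≤s)

∣∣-*-mono : ∀ p q {r s} → ∣ p ∣ ≤ r → ∣ q ∣ ≤ s → ∣ p * q ∣ ≤ r * s
∣∣-*-mono p q h k = subst (_≤ _) (sym (∣p*q∣≡∣p∣*∣q∣ p q))
  (*-mono-≤ (0≤∣p∣ p) (0≤∣p∣ q) h k)

∣*-*∣ : ∀ p q p′ q′ {A B δ ε} → ∣ p ∣ ≤ A → ∣ q′ ∣ ≤ B →
        ∣ p - p′ ∣ ≤ δ → ∣ q - q′ ∣ ≤ ε →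
        ∣ p * q - p′ * q′ ∣ ≤ A * ε + δ * B
∣*-*∣ p q p′ q′ hp hq hd he = ≤-trans
  (subst (λ z → ∣ z ∣ ≤ ∣ p * (q - q′) ∣ + ∣ (p - p′) * q′ ∣)
    (solve 4 (λ p q p′ q′ → p :* (q :- q′) :+ (p :- p′) :* q′ := p :* q :- p′ :* q′)
      refl p q p′ q′)
    (∣p+q∣≤∣p∣+∣q∣ (p * (q - q′)) ((p - p′) * q′)))
  (+-mono-≤ (∣∣-*-mono p (q - q′) hp he) (∣∣-*-mono (p - p′) q′ hd hq))

0<½ : 0ℚ < ½
0<½ = positive⁻¹ ½

0<1 : 0ℚ < 1ℚ
0<1 = positive⁻¹ 1ℚ

*-pos : ∀ {p q} → 0ℚ < p → 0ℚ < q → 0ℚ < p * q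
*-pos {p} {q} h k =
  positive⁻¹ (p * q) {{pos*pos⇒pos p {{positive h}} q {{positive k}}}}

½*ε+½*ε : ∀ ε → ½ * ε + ½ * ε ≡ ε
½*ε+½*ε ε = trans (sym (*-distribʳ-+ ε ½ ½)) (*-identityˡ ε)

-- Used to pick a δ with K * δ = ε.
scale : ∀ K ε → 0ℚ < K → 0ℚ < ε → Σ ℚ λ δ → 0ℚ < δ × K * δ ≡ ε
scale K ε 0<K 0<ε = (1/ K) * ε , *-pos (positive⁻¹ (1/ K) {{1/pos⇒pos K}}) 0<ε ,
  trans (sym (*-assoc K (1/ K) ε)) (trans (cong (_* ε) (*-inverseʳ K)) (*-identityˡ ε))
  where instance
    _ = positive 0<K
    _ = pos⇒nonZero K

⊓-pos : ∀ {p q} → 0ℚ < p → 0ℚ < q → 0ℚ < p ⊓ q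
⊓-pos {p} {q} h k with ⊓-sel p q
... | inj₁ e = subst (0ℚ <_) (sym e) h
... | inj₂ e = subst (0ℚ <_) (sym e) k

------------------------------------------------------------------------
-- Real numbers: Cauchy sequences of rationals (equality is x ≤ʳ y × y ≤ʳ x)

Eventually : (ℕ → Set) → Set
Eventually P = ∃ λ N → ∀ n → N ℕ.≤ n → P n

infixl 4 _⟨&⟩_

_⟨&⟩_ : ∀ {P Q} → Eventually P → Eventually Q → Eventually (λ n → P n × Q n)
(M , f) ⟨&⟩ (N , g) = M ℕ.⊔ N , λ n h →
  f n (ℕ.≤-trans (ℕ.m≤m⊔n M N) h) , g n (ℕ.≤-trans (ℕ.m≤n⊔m M N) h)

IsCauchy : (ℕ → ℚ) → Set
IsCauchy x = ∀ ε → 0ℚ < ε →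
  ∃ λ N → ∀ m n → N ℕ.≤ m → N ℕ.≤ n → ∣ x m - x n ∣ ≤ ε

record ℝ : Set where
  constructor mkℝ
  field
    seq    : ℕ → ℚ
    cauchy : IsCauchy seq

open ℝ public

infix 4 _≤ʳ_ _<ʳ_
infixl 6 _+ʳ_ _-ʳ_
infixl 7 _*ʳ_
infix 8 -ʳ_

_≤ʳ_ : ℝ → ℝ → Set
x ≤ʳ y = ∀ ε → 0ℚ < ε → Eventually λ n → seq x n ≤ seq y n + ε

_<ʳ_ : ℝ → ℝ → Set
x <ʳ y = ∃ λ ε → 0ℚ < ε × Eventually λ n → seq x n + ε ≤ seq y n

fromℚ : ℚ → ℝ
fromℚ q = mkℝ (λ _ → q) λ ε 0<ε → 0 , λ _ _ _ _ →
  ≤-trans (≤-reflexive (cong ∣_∣ (+-inverseʳ q))) (<⇒≤ 0<ε)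

_+ʳ_ : ℝ → ℝ → ℝ
x +ʳ y = mkℝ (λ n → seq x n + seq y n) λ ε 0<ε →
  let 0<½ε = *-pos 0<½ 0<ε
      M , f = cauchy x (½ * ε) 0<½ε
      N , g = cauchy y (½ * ε) 0<½ε
  in M ℕ.⊔ N , λ m n hm hn →
    subst (∣ (seq x m + seq y m) - (seq x n + seq y n) ∣ ≤_) (½*ε+½*ε ε)
      (∣+-+∣ (seq x m) (seq y m) (seq x n) (seq y n)
        (f m n (ℕ.≤-trans (ℕ.m≤m⊔n M N) hm) (ℕ.≤-trans (ℕ.m≤m⊔n M N) hn))
        (g m n (ℕ.≤-trans (ℕ.m≤n⊔m M N) hm) (ℕ.≤-trans (ℕ.m≤n⊔m M N) hn)))

-ʳ_ : ℝ → ℝ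
-ʳ x = mkℝ (λ n → - seq x n) λ ε 0<ε →
  let N , f = cauchy x ε 0<ε
  in N , λ m n hm hn → subst (_≤ ε)
    (trans (∣p-q∣-sym (seq x m) (seq x n))
      (cong ∣_∣ (solve 2 (λ a b → b :- a := (:- a) :- (:- b)) refl (seq x m) (seq x n))))
    (f m n hm hn)

_-ʳ_ : ℝ → ℝ → ℝ
x -ʳ y = x +ʳ (-ʳ y)

∣_∣ʳ : ℝ → ℝ
∣ x ∣ʳ = mkℝ (λ n → ∣ seq x n ∣) λ ε 0<ε →
  let N , f = cauchy x ε 0<ε in N , λ m n hm hn → ∣∣-close {seq x m} {seq x n} (f m n hm hn)

eventuallyBounded : ∀ x → ∃ λ B → 0ℚ < B × Eventually λ n → ∣ seq x n ∣ ≤ B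
eventuallyBounded x =
  let N , f = cauchy x 1ℚ 0<1
  in ∣ seq x N ∣ + 1ℚ
   , <-≤-trans 0<1 (subst (_≤ ∣ seq x N ∣ + 1ℚ) (+-identityˡ 1ℚ) (+-monoˡ-≤ 1ℚ (0≤∣p∣ (seq x N))))
   , N , λ n h → closeˡ (∣∣-close {seq x n} {seq x N} (f n N h ℕ.≤-refl))

_*ʳ_ : ℝ → ℝ → ℝ
x *ʳ y = mkℝ (λ n → seq x n * seq y n) λ ε 0<ε →
  let A , 0<A , bx = eventuallyBounded x
      B , 0<B , by = eventuallyBounded y
      0<A+B = +-mono-< 0<A 0<B
      δ , 0<δ , eq = scale (A + B) ε 0<A+B 0<ε
      M , f = cauchy x δ 0<δ
      N , g = cauchy y δ 0<δ
      K , b = bx ⟨&⟩ by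
      M≤ = λ {n} → ℕ.≤-trans {M} {_} {n} (ℕ.m≤m⊔n M (N ℕ.⊔ K))
      N≤ = λ {n} → ℕ.≤-trans {N} {_} {n} (ℕ.≤-trans (ℕ.m≤m⊔n N K) (ℕ.m≤n⊔m M (N ℕ.⊔ K)))
      K≤ = λ {n} → ℕ.≤-trans {K} {_} {n} (ℕ.≤-trans (ℕ.m≤n⊔m N K) (ℕ.m≤n⊔m M (N ℕ.⊔ K)))
  in M ℕ.⊔ (N ℕ.⊔ K) , λ m n hm hn →
    subst (∣ seq x m * seq y m - seq x n * seq y n ∣ ≤_)
      (trans (solve 3 (λ a b d → a :* d :+ d :* b := (a :+ b) :* d) refl A B δ) eq)
      (∣*-*∣ (seq x m) (seq y m) (seq x n) (seq y n)
        (proj₁ (b m (K≤ hm))) (proj₂ (b n (K≤ hn)))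
        (f m n (M≤ hm) (M≤ hn)) (g m n (N≤ hm) (N≤ hn)))

-- Approximating from below is the constructive form of "least": it implies
-- that every upper bound t of S satisfies s ≤ʳ t.
record IsSupremum (S : ℝ → Set) (s : ℝ) : Set where
  field
    upperBound   : ∀ y → S y → y ≤ʳ s
    approximable : ∀ t → t <ʳ s → ∃ λ y → S y × t <ʳ y

------------------------------------------------------------------------
-- Real polynomials of degree at most d, as coefficient vectors listed from
-- the constant term upwards (the leading coefficient may vanish)

Polynomial : ℕ → Set
Polynomial d = Vec ℝ (suc d)

infixl 6 _-ᵖ_

_-ᵖ_ : ∀ {k} → Vec ℝ k → Vec ℝ k → Vec ℝ k
_-ᵖ_ = zipWith _-ʳ_

⟦_⟧ : ∀ {k} → Vec ℝ k → ℝ → ℝ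
⟦ [] ⟧    x = fromℚ 0ℚ
⟦ c ∷ p ⟧ x = c +ʳ x *ʳ ⟦ p ⟧ x

-- The set { ∣ p(x) ∣ : x ∈ [-1,1] }. Using ≡ here fixes representatives, which
-- affects neither its upper bounds nor its supremum.
AbsValue : ∀ {k} → Vec ℝ k → ℝ → Set
AbsValue p y = ∃ λ x → (fromℚ (- 1ℚ) ≤ʳ x × x ≤ʳ fromℚ 1ℚ) × y ≡ ∣ ⟦ p ⟧ x ∣ʳ

------------------------------------------------------------------------
-- The supremum norm on [-1,1]. Its n-th approximation is the maximum of the
-- n-th rational approximation of ∣ p ∣ over the dyadic grid of mesh 2/2ⁿ.

evalℚ : ∀ {k} → Vec ℚ k → ℚ → ℚ
evalℚ []      x = 0ℚ
evalℚ (c ∷ p) x = c + x * evalℚ p x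

approx : ∀ {k} → Vec ℝ k → ℕ → Vec ℚ k
approx p n = map (λ c → seq c n) p

gridMax : (ℚ → ℚ) → ℕ → ℚ → ℚ → ℚ
gridMax f zero    a b = f a ⊔ f b
gridMax f (suc n) a b = gridMax f n a (½ * (a + b)) ⊔ gridMax f n (½ * (a + b)) b

normSeq : ∀ {k} → Vec ℝ k → ℕ → ℚ
normSeq p n = gridMax (λ x → ∣ evalℚ (approx p n) x ∣) n (- 1ℚ) 1ℚ

½^_ : ℕ → ℚ
½^ zero  = 1ℚ
½^ suc n = ½ * ½^ n

a≤mid : ∀ {a b} → a ≤ b → a ≤ ½ * (a + b)
a≤mid {a} {b} h = subst (_≤ ½ * (a + b)) (½*ε+½*ε a)
  (subst (½ * a + ½ * a ≤_) (sym (*-distribˡ-+ ½ a b))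
    (+-monoʳ-≤ (½ * a) (*-monoˡ-≤-nonNeg ½ h)))

mid≤b : ∀ {a b} → a ≤ b → ½ * (a + b) ≤ b
mid≤b {a} {b} h = subst (½ * (a + b) ≤_) (½*ε+½*ε b)
  (subst (_≤ ½ * b + ½ * b) (sym (*-distribˡ-+ ½ a b))
    (+-monoˡ-≤ (½ * b) (*-monoˡ-≤-nonNeg ½ h)))

mid-a : ∀ a b → ½ * (a + b) - a ≡ ½ * (b - a)
mid-a a b = trans (cong (λ z → ½ * (a + b) - z) (sym (½*ε+½*ε a)))
  (solve 3 (λ h a b → h :* (a :+ b) :- (h :* a :+ h :* a) := h :* (b :- a)) refl ½ a b)

b-mid : ∀ a b → b - ½ * (a + b) ≡ ½ * (b - a)
b-mid a b = trans (cong (λ z → z - ½ * (a + b)) (sym (½*ε+½*ε b)))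
  (solve 3 (λ h a b → (h :* b :+ h :* b) :- h :* (a :+ b) := h :* (b :- a)) refl ½ a b)

gridMax-attained : ∀ f n {a b} → a ≤ b →
  ∃ λ x → a ≤ x × x ≤ b × gridMax f n a b ≡ f x
gridMax-attained f zero {a} {b} h with ⊔-sel (f a) (f b)
... | inj₁ e = a , ≤-refl , h , e
... | inj₂ e = b , h , ≤-refl , e
gridMax-attained f (suc n) {a} {b} h
  with ⊔-sel (gridMax f n a (½ * (a + b))) (gridMax f n (½ * (a + b)) b)
... | inj₁ e = let x , l , u , q = gridMax-attained f n (a≤mid h)
               in x , l , ≤-trans u (mid≤b h) , trans e q
... | inj₂ e = let x , l , u , q = gridMax-attained f n (mid≤b h)
               in x , ≤-trans (a≤mid h) l , u , trans e q

gridMax-near : ∀ f n {a b} y → a ≤ y → y ≤ b →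
  ∃ λ x → a ≤ x × x ≤ b × ∣ y - x ∣ ≤ ½^ n * (b - a) × f x ≤ gridMax f n a b
gridMax-near f zero {a} {b} y l u = a , ≤-refl , ≤-trans l u , dist , p≤p⊔q (f a) (f b)
  where
  dist : ∣ y - a ∣ ≤ 1ℚ * (b - a)
  dist = subst₂ _≤_
    (sym (0≤p⇒∣p∣≡p (subst (_≤ y - a) (+-inverseʳ a) (+-monoˡ-≤ (- a) l))))
    (sym (*-identityˡ (b - a))) (+-monoˡ-≤ (- a) u)
gridMax-near f (suc n) {a} {b} y l u with ≤-total y (½ * (a + b))
... | inj₁ v = let x , p , q , d , m = gridMax-near f n y l v
               in x , p , ≤-trans q (mid≤b (≤-trans l u))
                , subst (∣ y - x ∣ ≤_) (trans (cong (½^ n *_) (mid-a a b))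
                    (solve 3 (λ h w d → w :* (h :* d) := (h :* w) :* d) refl ½ (½^ n) (b - a))) d
                , ≤-trans m (p≤p⊔q (gridMax f n a (½ * (a + b))) (gridMax f n (½ * (a + b)) b))
... | inj₂ v = let x , p , q , d , m = gridMax-near f n y v u
               in x , ≤-trans (a≤mid (≤-trans l u)) p , q
                , subst (∣ y - x ∣ ≤_) (trans (cong (½^ n *_) (b-mid a b))
                    (solve 3 (λ h w d → w :* (h :* d) := (h :* w) :* d) refl ½ (½^ n) (b - a))) d
                , ≤-trans m (p≤q⊔p (gridMax f n a (½ * (a + b))) (gridMax f n (½ * (a + b)) b))

fromℕ : ℕ → ℚ
fromℕ zero    = 0ℚ
fromℕ (suc n) = 1ℚ + fromℕ n

0≤fromℕ : ∀ n → 0ℚ ≤ fromℕ n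
0≤fromℕ zero    = ≤-refl
0≤fromℕ (suc n) = +-mono-≤ (<⇒≤ 0<1) (0≤fromℕ n)

fromℕ-mono : ∀ {m n} → m ℕ.≤ n → fromℕ m ≤ fromℕ n
fromℕ-mono {n = n} ℕ.z≤n = 0≤fromℕ n
fromℕ-mono (ℕ.s≤s h)     = +-monoʳ-≤ 1ℚ (fromℕ-mono h)

toℚᵘ-fromℕ : ∀ n → toℚᵘ (fromℕ n) ℚᵘ.≃ ℚᵘ.mkℚᵘ (ℤ.+ n) 0
toℚᵘ-fromℕ zero    = ℚᵘ.≃-refl
toℚᵘ-fromℕ (suc n) = ℚᵘ.≃-trans (toℚᵘ-homo-+ 1ℚ (fromℕ n))
  (ℚᵘ.≃-trans (ℚᵘ.+-congʳ (toℚᵘ 1ℚ) (toℚᵘ-fromℕ n))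
    (ℚᵘ.*≡* (cong (ℤ._* ℤ.+ 1) (cong (λ z → ℤ.+ 1 ℤ.+ z) (ℤ.*-identityʳ (ℤ.+ n))))))

archimedean : ∀ q → ∃ λ N → q ≤ fromℕ N
archimedean q@(mkℚ n d _) = ℤ.∣ n ∣ , toℚᵘ-cancel-≤
  (ℚᵘ.≤-trans (ℚᵘ.*≤* le) (ℚᵘ.≤-reflexive (ℚᵘ.≃-sym (toℚᵘ-fromℕ ℤ.∣ n ∣))))
  where
  n≤∣n∣ : ∀ i → i ℤ.≤ ℤ.+ ℤ.∣ i ∣
  n≤∣n∣ (ℤ.+ n)      = ℤ.≤-refl
  n≤∣n∣ (ℤ.-[1+ n ]) = ℤ.-≤+

  le : n ℤ.* ℤ.+ 1 ℤ.≤ ℤ.+ ℤ.∣ n ∣ ℤ.* ℤ.+ suc d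
  le = subst₂ ℤ._≤_ (sym (ℤ.*-identityʳ n)) (ℤ.pos-* ℤ.∣ n ∣ (suc d))
    (ℤ.≤-trans (n≤∣n∣ n) (ℤ.+≤+ (ℕ.m≤m*n ℤ.∣ n ∣ (suc d))))

0<½^ : ∀ n → 0ℚ < ½^ n
0<½^ zero    = 0<1
0<½^ (suc n) = *-pos 0<½ (0<½^ n)

½^≤1 : ∀ n → ½^ n ≤ 1ℚ
½^≤1 zero    = ≤-refl
½^≤1 (suc n) = *-mono-≤ {½} {1ℚ} (<⇒≤ 0<½) (<⇒≤ (0<½^ n)) (≤ᵇ⇒≤ _) (½^≤1 n)

fromℕ*½^≤1 : ∀ n → fromℕ n * ½^ n ≤ 1ℚ
fromℕ*½^≤1 zero    = <⇒≤ 0<1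
fromℕ*½^≤1 (suc n) = subst (_≤ 1ℚ)
  (trans (sym (*-distribˡ-+ ½ (½^ n) (fromℕ n * ½^ n)))
    (trans (cong (λ z → ½ * (z + fromℕ n * ½^ n)) (sym (*-identityˡ (½^ n))))
      (solve 4 (λ h o n w → h :* (o :* w :+ n :* w) := (o :+ n) :* (h :* w))
        refl ½ 1ℚ (fromℕ n) (½^ n))))
  (+-mono-≤ (*-monoˡ-≤-nonNeg ½ (½^≤1 n)) (*-monoˡ-≤-nonNeg ½ (fromℕ*½^≤1 n)))

½^-small : ∀ d ε → 0ℚ < d → 0ℚ < ε → Eventually λ n → ½^ n * d ≤ ε
½^-small d ε 0<d 0<ε =
  let K , _ , εK≡d = scale ε d 0<ε 0<d
      N , K≤N = archimedean K
  in N , λ n N≤n → subst (λ z → ½^ n * z ≤ ε) εK≡d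
    (subst₂ _≤_
      (solve 3 (λ e k w → e :* (k :* w) := w :* (e :* k)) refl ε K (½^ n)) (*-identityʳ ε)
      (*-monoˡ-≤-nonNeg ε {{nonNegative (<⇒≤ 0<ε)}}
        (≤-trans
          (*-monoʳ-≤-nonNeg (½^ n) {{nonNegative (<⇒≤ (0<½^ n))}}
            (≤-trans K≤N (fromℕ-mono N≤n)))
          (fromℕ*½^≤1 n))))

2ℚ : ℚ
2ℚ = 1ℚ + 1ℚ

0<2 : 0ℚ < 2ℚ
0<2 = positive⁻¹ 2ℚ

approx-bounded : ∀ {k} (p : Vec ℝ k) → ∃ λ B → 0ℚ < B ×
  Eventually λ n → ∀ x → ∣ x ∣ ≤ 2ℚ → ∣ evalℚ (approx p n) x ∣ ≤ B
approx-bounded []      = 1ℚ , 0<1 , 0 , λ _ _ _ _ → <⇒≤ 0<1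
approx-bounded (c ∷ p) =
  let A , 0<A , bc = eventuallyBounded c
      B , 0<B , bp = approx-bounded p
      N , b = bc ⟨&⟩ bp
  in A + 2ℚ * B , +-mono-< 0<A (*-pos 0<2 0<B) , N , λ n h x hx →
    ≤-trans (∣p+q∣≤∣p∣+∣q∣ (seq c n) (x * evalℚ (approx p n) x))
      (+-mono-≤ (proj₁ (b n h))
        (∣∣-*-mono x (evalℚ (approx p n) x) hx (proj₂ (b n h) x hx)))

approx-continuous : ∀ {k} (p : Vec ℝ k) ε → 0ℚ < ε → ∃ λ δ → 0ℚ < δ × ∃ λ N →
  ∀ m n → N ℕ.≤ m → N ℕ.≤ n → ∀ x y → ∣ x ∣ ≤ 2ℚ → ∣ y ∣ ≤ 2ℚ → ∣ x - y ∣ ≤ δ →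
  ∣ evalℚ (approx p m) x - evalℚ (approx p n) y ∣ ≤ ε
approx-continuous []      ε 0<ε = 1ℚ , 0<1 , 0 , λ _ _ _ _ _ _ _ _ _ → <⇒≤ 0<ε
approx-continuous (c ∷ p) ε 0<ε =
  let 0<ε₂ = *-pos 0<½ 0<ε
      ε₂ = ½ * ε
      ε₄ = ½ * ε₂
      0<ε₄ = *-pos 0<½ 0<ε₂
      B , 0<B , K , b = approx-bounded p
      ε′ , 0<ε′ , 2ε′ = scale 2ℚ ε₄ 0<2 0<ε₄
      δ′ , 0<δ′ , Bδ′ = scale B ε₄ 0<B 0<ε₄
      δ″ , 0<δ″ , M , f = approx-continuous p ε′ 0<ε′
      L , g = cauchy c ε₂ 0<ε₂
      K≤ = λ {n} → ℕ.≤-trans {K} {_} {n} (ℕ.m≤m⊔n K (M ℕ.⊔ L))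
      M≤ = λ {n} → ℕ.≤-trans {M} {_} {n} (ℕ.≤-trans (ℕ.m≤m⊔n M L) (ℕ.m≤n⊔m K (M ℕ.⊔ L)))
      L≤ = λ {n} → ℕ.≤-trans {L} {_} {n} (ℕ.≤-trans (ℕ.m≤n⊔m M L) (ℕ.m≤n⊔m K (M ℕ.⊔ L)))
  in δ′ ⊓ δ″ , ⊓-pos 0<δ′ 0<δ″ , K ℕ.⊔ (M ℕ.⊔ L) , λ m n hm hn x y hx hy hxy →
    let u = evalℚ (approx p m) x
        v = evalℚ (approx p n) y
    in subst (∣ (seq c m + x * u) - (seq c n + y * v) ∣ ≤_)
      (trans (cong (λ z → ε₂ + z)
        (trans (cong₂ _+_ 2ε′ (trans (*-comm δ′ B) Bδ′)) (½*ε+½*ε ε₂))) (½*ε+½*ε ε))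
      (∣+-+∣ (seq c m) (x * u) (seq c n) (y * v)
        (g m n (L≤ hm) (L≤ hn))
        (∣*-*∣ x u y v hx (b n (K≤ hn) y hy)
          (≤-trans hxy (p⊓q≤p δ′ δ″))
          (f m n (M≤ hm) (M≤ hn) x y hx hy (≤-trans hxy (p⊓q≤q δ′ δ″)))))

1≤2 : 1ℚ ≤ 2ℚ
1≤2 = ≤ᵇ⇒≤ _

∣x∣≤1 : ∀ {x} → - 1ℚ ≤ x → x ≤ 1ℚ → ∣ x ∣ ≤ 1ℚ
∣x∣≤1 {x} l u = ∣p∣≤q u
  (shift l (solve 2 (λ x o → x :- (:- o) := o :- (:- x)) refl x 1ℚ))

∣x∣≤2 : ∀ {x} → - 1ℚ ≤ x → x ≤ 1ℚ → ∣ x ∣ ≤ 2ℚ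
∣x∣≤2 l u = ≤-trans (∣x∣≤1 l u) 1≤2

clamp : ∀ x {η} → 0ℚ ≤ η → - 1ℚ ≤ x + η → x ≤ 1ℚ + η →
  ∃ λ y → - 1ℚ ≤ y × y ≤ 1ℚ × ∣ x - y ∣ ≤ η
clamp x {η} 0≤η l u with ≤-total x (- 1ℚ) | ≤-total x 1ℚ
... | inj₁ h | _ = - 1ℚ , ≤-refl , ≤ᵇ⇒≤ _ , close (≤-trans h (p≤p+q 0≤η (- 1ℚ))) l
... | inj₂ _ | inj₂ h = 1ℚ , ≤ᵇ⇒≤ _ , ≤-refl , close u (≤-trans h (p≤p+q 0≤η x))
... | inj₂ k | inj₁ h = x , k , h , subst (_≤ η) (sym (cong ∣_∣ (+-inverseʳ x))) 0≤η

∣eval∣≤normSeq : ∀ {k} (p : Vec ℝ k) ε → 0ℚ < ε → ∃ λ η → 0ℚ < η × ∃ λ N →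
  ∀ m n → N ℕ.≤ m → N ℕ.≤ n → ∀ x → - 1ℚ ≤ x + η → x ≤ 1ℚ + η →
  ∣ evalℚ (approx p m) x ∣ ≤ normSeq p n + ε
∣eval∣≤normSeq p ε 0<ε =
  let δ , 0<δ , M , f = approx-continuous p ε 0<ε
      0<δ₂ = *-pos 0<½ 0<δ
      L , g = ½^-small (1ℚ - - 1ℚ) (½ * δ) (positive⁻¹ (1ℚ - - 1ℚ)) 0<δ₂
      η = 1ℚ ⊓ (½ * δ)
      0<η = ⊓-pos 0<1 0<δ₂
  in η , 0<η , M ℕ.⊔ L , λ m n hm hn x l u →
    let y , -1≤y , y≤1 , x~y = clamp x (<⇒≤ 0<η) l u
        F = λ z → ∣ evalℚ (approx p n) z ∣
        z , -1≤z , z≤1 , y~z , Fz≤ = gridMax-near F n y -1≤y y≤1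
        ∣x∣≤ = ≤-trans (closeˡ (∣∣-close {x} {y} (≤-trans x~y (p⊓q≤p 1ℚ (½ * δ)))))
                 (+-monoˡ-≤ 1ℚ (∣x∣≤1 -1≤y y≤1))
        x~z = subst (∣ x - z ∣ ≤_) (½*ε+½*ε δ)
          (∣-∣-triangle x y z (≤-trans x~y (p⊓q≤q 1ℚ (½ * δ)))
            (≤-trans y~z (g n (ℕ.≤-trans (ℕ.m≤n⊔m M L) hn))))
    in ≤-trans
      (closeˡ (∣∣-close {evalℚ (approx p m) x} {evalℚ (approx p n) z}
        (f m n (ℕ.≤-trans (ℕ.m≤m⊔n M L) hm) (ℕ.≤-trans (ℕ.m≤m⊔n M L) hn)
          x z ∣x∣≤ (∣x∣≤2 -1≤z z≤1) x~z)))
      (+-monoˡ-≤ ε Fz≤)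

normSeq-cauchy : ∀ {k} (p : Vec ℝ k) → IsCauchy (normSeq p)
normSeq-cauchy p ε 0<ε =
  let η , 0<η , N , f = ∣eval∣≤normSeq p ε 0<ε
      le = λ m n (hm : N ℕ.≤ m) (hn : N ℕ.≤ n) →
        let y , l , u , e = gridMax-attained (λ x → ∣ evalℚ (approx p m) x ∣) m -1≤1
        in subst (_≤ normSeq p n + ε) (sym e)
             (f m n hm hn y (≤-trans l (p≤p+q (<⇒≤ 0<η) y)) (≤-trans u (p≤p+q (<⇒≤ 0<η) 1ℚ)))
  in N , λ m n hm hn → close (le m n hm hn) (le n m hn hm)
  where
  -1≤1 : - 1ℚ ≤ 1ℚ
  -1≤1 = ≤ᵇ⇒≤ _

‖_‖∞ : ∀ {k} → Vec ℝ k → ℝ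
‖ p ‖∞ = mkℝ (normSeq p) (normSeq-cauchy p)

seq-⟦⟧ : ∀ {k} (p : Vec ℝ k) x n → seq (⟦ p ⟧ x) n ≡ evalℚ (approx p n) (seq x n)
seq-⟦⟧ []      x n = refl
seq-⟦⟧ (c ∷ p) x n = cong (λ z → seq c n + seq x n * z) (seq-⟦⟧ p x n)

‖‖∞-isSupremum : ∀ {k} (p : Vec ℝ k) → IsSupremum (AbsValue p) ‖ p ‖∞
‖‖∞-isSupremum p = record { upperBound = ub ; approximable = ap }
  where
  ub : ∀ y → AbsValue p y → y ≤ʳ ‖ p ‖∞
  ub _ (x , (l , u) , refl) ε 0<ε =
    let η , 0<η , N , f = ∣eval∣≤normSeq p ε 0<ε
        M , g = l η 0<η ⟨&⟩ u η 0<η ⟨&⟩ (N , λ _ h → h)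
    in M , λ n h → let (l′ , u′) , N≤n = g n h in
      subst (λ z → ∣ z ∣ ≤ normSeq p n + ε) (sym (seq-⟦⟧ p x n))
        (f n n N≤n N≤n (seq x n) l′ u′)

  ap : ∀ t → t <ʳ ‖ p ‖∞ → ∃ λ y → AbsValue p y × t <ʳ y
  ap t (ε , 0<ε , T , t<s) =
    let ε₂ = ½ * ε
        0<ε₂ = *-pos 0<½ 0<ε
        ε₄ = ½ * ε₂
        0<ε₄ = *-pos 0<½ 0<ε₂
        δ , 0<δ , M , f = approx-continuous p ε₄ 0<ε₄
        L , g = normSeq-cauchy p ε₄ 0<ε₄
        K , b = (T , t<s) ⟨&⟩ (M , λ _ h → h) ⟨&⟩ (L , λ _ h → h)
        x , l , u , e = gridMax-attained (λ z → ∣ evalℚ (approx p K) z ∣) K (≤ᵇ⇒≤ _)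
        (_ , M≤K) , L≤K = b K ℕ.≤-refl
        v = λ n → evalℚ (approx p n) x
    in ∣ ⟦ p ⟧ (fromℚ x) ∣ʳ
     , (fromℚ x , ( (λ ε h → 0 , λ _ _ → ≤-trans l (p≤p+q (<⇒≤ h) x))
                  , (λ ε h → 0 , λ _ _ → ≤-trans u (p≤p+q (<⇒≤ h) 1ℚ)) ) , refl)
     , ε₂ , 0<ε₂ , K , λ n K≤n →
       let (t+ε≤s , M≤n) , L≤n = b n K≤n
           sn≤sK = closeˡ (g n K L≤n L≤K)
           sK≤v = ≤-trans (≤-reflexive e) (closeˡ (∣∣-close {v K} {v n}
                    (f K n M≤K M≤n x x (∣x∣≤2 l u) (∣x∣≤2 l u)
                      (subst (_≤ δ) (sym (cong ∣_∣ (+-inverseʳ x))) (<⇒≤ 0<δ)))))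
           sn≤v = ≤-trans sn≤sK (+-monoˡ-≤ ε₄ sK≤v)
       in subst (λ z → seq t n + ε₂ ≤ ∣ z ∣) (sym (seq-⟦⟧ p (fromℚ x) n))
         (shift (≤-trans t+ε≤s sn≤v)
           (trans
             (cong (λ z → (∣ v n ∣ + ε₄ + ε₄) - (seq t n + z)) (sym (½*ε+½*ε ε)))
             (trans
               (solve 4 (λ w q t h → (w :+ q :+ q) :- (t :+ (h :+ h))
                                  := w :+ (q :+ q) :- (t :+ h) :- h)
                 refl ∣ v n ∣ ε₄ (seq t n) ε₂)
               (trans
                 (cong (λ z → ∣ v n ∣ + z - (seq t n + ε₂) - ε₂) (½*ε+½*ε ε₂))
                 (solve 3 (λ w t h → w :+ h :- (t :+ h) :- h := w :- (t :+ h))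
                   refl ∣ v n ∣ (seq t n) ε₂)))))

{-# OPTIONS --safe #-}

-- Take p₀ = 1 + 2x - x², p₁ = 2 - 2x² and p₂ = 0. The differences
-- p₀ - p₂ = 2 - (1-x)², p₁ - p₂ = 2 - 2x² and p₀ - p₁ = (1+x)² - 2 are bounded
-- by 2 on [-1,1]. The functional L q = q(1) - 2q(½) + 2q(-½) - q(-1), a multiple
-- of a third divided difference, kills all q of degree ≤ 2, so that
--   (p₀-q)(1) + 2(q-p₂)(½) + 2(p₁-q)(-½) + (q-p₀)(-1) = 2 + 0 + 3 + 2 = 7,
-- and as the weights add up to 6, one of the four differences is at least 7/6.
module Submission where

open import Defs
open import Data.Fin using (Fin; zero; suc)
open import Data.Integer using (+_)
open import Data.Nat.Base as ℕ using (ℕ)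
import Data.Nat.Properties as ℕ
open import Data.Product using (∃; _×_; _,_; proj₁; proj₂)
open import Data.Rational using (_/_)
open import Data.Rational.Base
open import Data.Rational.Properties
open import Data.Rational.Solver using (module +-*-Solver)
open import Data.Sum using (_⊎_; inj₁; inj₂)
open import Data.Vec.Base using (Vec; []; _∷_)
open import Relation.Binary.PropositionalEquality
open import Relation.Nullary using (yes; no; contradiction; from-yes)

open +-*-Solver using (solve; con; _:=_; _:+_; _:*_; _:-_)
  renaming (Polynomial to Expr)

0≤* : ∀ {p q} → 0ℚ ≤ p → 0ℚ ≤ q → 0ℚ ≤ p * q
0≤* {p} {q} h k = subst (_≤ p * q) (*-zeroˡ q) (*-mono-≤ {0ℚ} {p} {q} ≤-refl k h ≤-refl)

0≤x*x : ∀ x → 0ℚ ≤ x * x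
0≤x*x x with ≤-total 0ℚ x
... | inj₁ h = 0≤* h h
... | inj₂ h = subst (0ℚ ≤_) (solve 1 (λ x → (con 0ℚ :- x) :* (con 0ℚ :- x) := x :* x) refl x)
                 (0≤* 0≤-x 0≤-x)
  where
  0≤-x : 0ℚ ≤ 0ℚ - x
  0≤-x = shift h (solve 1 (λ x → con 0ℚ :- x := (con 0ℚ :- x) :- con 0ℚ) refl x)

-- If all four values were below `t`, adding the strict inequalities would contradict `h`. The
-- weights 1, 2, 2, 1 are spelled as repeated summands so that `+-mono-<` alone suffices.
weighted-pigeonhole : ∀ t a b c d → t + (t + t) + (t + t) + t ≤ a + (b + b) + (c + c) + d →
  (t ≤ a ⊎ t ≤ b) ⊎ (t ≤ c ⊎ t ≤ d)
weighted-pigeonhole t a b c d h with t ≤? a | t ≤? b | t ≤? c | t ≤? d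
... | yes k | _     | _     | _     = inj₁ (inj₁ k)
... | _     | yes k | _     | _     = inj₁ (inj₂ k)
... | _     | _     | yes k | _     = inj₂ (inj₁ k)
... | _     | _     | _     | yes k = inj₂ (inj₂ k)
... | no ka | no kb | no kc | no kd = contradiction
  (<-≤-trans
    (+-mono-< (+-mono-< (+-mono-< (≰⇒> ka) (+-mono-< (≰⇒> kb) (≰⇒> kb)))
      (+-mono-< (≰⇒> kc) (≰⇒> kc))) (≰⇒> kd))
    h)
  (<-irrefl refl)

-- Gives one threshold valid for every index, so that it can be fixed before the index is chosen.
eventually-∀ : ∀ {k} {P : Fin k → ℕ → Set} → (∀ i → Eventually (P i)) →
  Eventually λ n → ∀ i → P i n
eventually-∀ {ℕ.zero}  h = 0 , λ _ _ ()
eventually-∀ {ℕ.suc k} h =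
  let N , f = h zero ⟨&⟩ eventually-∀ (λ i → h (suc i))
  in N , λ where
    n N≤n zero    → proj₁ (f n N≤n)
    n N≤n (suc i) → proj₂ (f n N≤n) i

evalℚ-approx-- : ∀ {k} (p q : Vec ℝ k) n x →
  evalℚ (approx (p -ᵖ q) n) x ≡ evalℚ (approx p n) x - evalℚ (approx q n) x
evalℚ-approx-- []      []      n x = refl
evalℚ-approx-- (c ∷ p) (d ∷ q) n x = trans
  (cong (λ z → (seq c n - seq d n) + x * z) (evalℚ-approx-- p q n x))
  (solve 5 (λ c d x u v → (c :- d) :+ x :* (u :- v) := (c :+ x :* u) :- (d :+ x :* v))
    refl (seq c n) (seq d n) x (evalℚ (approx p n) x) (evalℚ (approx q n) x))

-- Each term of `normSeq` is attained at a point of [-1,1], so a bound uniform in the stage carries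
-- over to the limit.
‖‖∞-upper : ∀ {k} (p : Vec ℝ k) B →
  (∀ n x → - 1ℚ ≤ x → x ≤ 1ℚ → ∣ evalℚ (approx p n) x ∣ ≤ B) → ‖ p ‖∞ ≤ʳ fromℚ B
‖‖∞-upper p B h ε 0<ε = 0 , λ n _ →
  let x , l , u , e = gridMax-attained (λ x → ∣ evalℚ (approx p n) x ∣) n -1≤1
  in ≤-trans (≤-trans (≤-reflexive e) (h n x l u)) (p≤p+q (<⇒≤ 0<ε) B)
  where
  -1≤1 : - 1ℚ ≤ 1ℚ
  -1≤1 = ≤ᵇ⇒≤ _

-- A large value at a single late stage `m` is enough: `∣eval∣≤normSeq` compares stage `m` with
-- every later stage of the norm up to an error chosen in advance, independent of `x`.
‖‖∞-lower : ∀ {k} (p : Vec ℝ k) {s t} → s < t → Eventually λ m →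
  ∀ x → - 1ℚ ≤ x → x ≤ 1ℚ → t ≤ ∣ evalℚ (approx p m) x ∣ → fromℚ s <ʳ ‖ p ‖∞
‖‖∞-lower p {s} {t} s<t =
  -- Half of the gap absorbs the approximation error; the other half remains as the margin
  -- witnessing `<ʳ`.
  let ε = ½ * (t - s)
      0<ε = *-pos 0<½ (subst (_< t - s) (+-inverseʳ s) (+-monoˡ-< (- s) s<t))
      η , 0<η , N , f = ∣eval∣≤normSeq p ε 0<ε
  in N , λ m N≤m x l u h → ε , 0<ε , N , λ n N≤n →
    shift (≤-trans h (f m n N≤m N≤n x (≤-trans l (p≤p+q (<⇒≤ 0<η) x))
                                      (≤-trans u (p≤p+q (<⇒≤ 0<η) 1ℚ))))
      (solve 3 (λ s t w → (w :+ con ½ :* (t :- s)) :- t := w :- (s :+ con ½ :* (t :- s)))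
        refl s t (normSeq p n))

p : Fin 3 → Polynomial 2
p zero             = fromℚ 1ℚ ∷ fromℚ 2ℚ ∷ fromℚ (- 1ℚ) ∷ []
p (suc zero)       = fromℚ 2ℚ ∷ fromℚ 0ℚ ∷ fromℚ (- 2ℚ) ∷ []
p (suc (suc zero)) = fromℚ 0ℚ ∷ fromℚ 0ℚ ∷ fromℚ 0ℚ ∷ []

-- For each pair, 2 minus the difference and 2 plus the difference are written as sums and products
-- of 2, 1 ± x, 3 ± x and x², all nonnegative on [-1,1].
p-close : ∀ i j n x → - 1ℚ ≤ x → x ≤ 1ℚ →
  ∣ evalℚ (approx (p i) n) x - evalℚ (approx (p j) n) x ∣ ≤ 2ℚ
p-close i j n x l u = go i j
  where
  val : Fin 3 → ℚ
  val i = evalℚ (approx (p i) n) x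

  0≤1+x : 0ℚ ≤ 1ℚ + x
  0≤1+x = shift l (solve 1 (λ x → x :- con (- 1ℚ) := (con 1ℚ :+ x) :- con 0ℚ) refl x)

  0≤1-x : 0ℚ ≤ 1ℚ - x
  0≤1-x = shift u (solve 1 (λ x → con 1ℚ :- x := (con 1ℚ :- x) :- con 0ℚ) refl x)

  0≤3+x : 0ℚ ≤ 2ℚ + (1ℚ + x)
  0≤3+x = +-mono-≤ (<⇒≤ 0<2) 0≤1+x

  0≤3-x : 0ℚ ≤ 2ℚ + (1ℚ - x)
  0≤3-x = +-mono-≤ (<⇒≤ 0<2) 0≤1-x

  -- Horner forms with the final zero term kept, so that they unfold to the same expressions as
  -- `val`.
  P0 P1 P2 : Expr 1 → Expr 1
  P0 = λ x → con 1ℚ :+ x :* (con 2ℚ :+ x :* (con (- 1ℚ) :+ x :* con 0ℚ))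
  P1 = λ x → con 2ℚ :+ x :* (con 0ℚ :+ x :* (con (- 2ℚ) :+ x :* con 0ℚ))
  P2 = λ x → con 0ℚ :+ x :* (con 0ℚ :+ x :* (con 0ℚ :+ x :* con 0ℚ))

  c01 : ∣ val zero - val (suc zero) ∣ ≤ 2ℚ
  c01 = close {val zero} {val (suc zero)}
    (shift (0≤* 0≤1-x 0≤3+x)
      (solve 1 (λ x → (con 1ℚ :- x) :* (con 2ℚ :+ (con 1ℚ :+ x)) :- con 0ℚ
                   := (P1 x :+ con 2ℚ) :- P0 x) refl x))
    (shift (0≤* 0≤1+x 0≤1+x)
      (solve 1 (λ x → (con 1ℚ :+ x) :* (con 1ℚ :+ x) :- con 0ℚ
                   := (P0 x :+ con 2ℚ) :- P1 x) refl x))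

  c02 : ∣ val zero - val (suc (suc zero)) ∣ ≤ 2ℚ
  c02 = close {val zero} {val (suc (suc zero))}
    (shift (0≤* 0≤1-x 0≤1-x)
      (solve 1 (λ x → (con 1ℚ :- x) :* (con 1ℚ :- x) :- con 0ℚ
                   := (P2 x :+ con 2ℚ) :- P0 x) refl x))
    (shift (0≤* 0≤1+x 0≤3-x)
      (solve 1 (λ x → (con 1ℚ :+ x) :* (con 2ℚ :+ (con 1ℚ :- x)) :- con 0ℚ
                   := (P0 x :+ con 2ℚ) :- P2 x) refl x))

  c12 : ∣ val (suc zero) - val (suc (suc zero)) ∣ ≤ 2ℚ
  c12 = close {val (suc zero)} {val (suc (suc zero))}
    (shift (0≤* (<⇒≤ 0<2) (0≤x*x x))
      (solve 1 (λ x → con 2ℚ :* (x :* x) :- con 0ℚ := (P2 x :+ con 2ℚ) :- P1 x) refl x))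
    (shift (+-mono-≤ (<⇒≤ 0<2) (0≤* (<⇒≤ 0<2) (0≤* 0≤1+x 0≤1-x)))
      (solve 1 (λ x → (con 2ℚ :+ con 2ℚ :* ((con 1ℚ :+ x) :* (con 1ℚ :- x))) :- con 0ℚ
                   := (P1 x :+ con 2ℚ) :- P2 x) refl x))

  diag : ∀ i → ∣ val i - val i ∣ ≤ 2ℚ
  diag i = subst (λ z → ∣ z ∣ ≤ 2ℚ) (sym (+-inverseʳ (val i))) (<⇒≤ 0<2)

  flip : ∀ i j → ∣ val i - val j ∣ ≤ 2ℚ → ∣ val j - val i ∣ ≤ 2ℚ
  flip i j = subst (_≤ 2ℚ) (∣p-q∣-sym (val i) (val j))

  go : ∀ i j → ∣ val i - val j ∣ ≤ 2ℚ
  go zero             zero             = diag zero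
  go zero             (suc zero)       = c01
  go zero             (suc (suc zero)) = c02
  go (suc zero)       zero             = flip zero (suc zero) c01
  go (suc zero)       (suc zero)       = diag (suc zero)
  go (suc zero)       (suc (suc zero)) = c12
  go (suc (suc zero)) zero             = flip zero (suc (suc zero)) c02
  go (suc (suc zero)) (suc zero)       = flip (suc zero) (suc (suc zero)) c12
  go (suc (suc zero)) (suc (suc zero)) = diag (suc (suc zero))

-- Order on ℚ is decidable, so the pigeonhole runs on the `m`-th rational approximation of `q`; the
-- resulting `i` and `x` may depend on `m`.
p-far : ∀ (q : Polynomial 2) m → ∃ λ i → ∃ λ x → - 1ℚ ≤ x × x ≤ 1ℚ ×
  + 7 / 6 ≤ ∣ evalℚ (approx q m) x - evalℚ (approx (p i) m) x ∣
p-far q@(a ∷ b ∷ c ∷ []) m = choose (weighted-pigeonhole (+ 7 / 6)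
    (Q (- 1ℚ) - P zero (- 1ℚ)) (P (suc zero) (- ½) - Q (- ½))
    (Q ½ - P (suc (suc zero)) ½) (P zero 1ℚ - Q 1ℚ)
    -- Six copies of 7/6 compute to the 7 in `identity`.
    (≤-reflexive (sym identity)))
  where
  Q : ℚ → ℚ
  Q = evalℚ (approx q m)

  P : Fin 3 → ℚ → ℚ
  P i = evalℚ (approx (p i) m)

  identity : (Q (- 1ℚ) - P zero (- 1ℚ)) + ((P (suc zero) (- ½) - Q (- ½)) + (P (suc zero) (- ½) - Q (- ½)))
    + ((Q ½ - P (suc (suc zero)) ½) + (Q ½ - P (suc (suc zero)) ½)) + (P zero 1ℚ - Q 1ℚ) ≡ + 7 / 1
  -- Only the coefficients of `q` are variables, and they cancel; the values of the `p i` at the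
  -- nodes are closed rationals and enter as constants.
  identity = solve 3 (λ a b c →
    let Q : ℚ → Expr 3
        Q = λ x → a :+ con x :* (b :+ con x :* (c :+ con x :* con 0ℚ))
        P′ : Fin 3 → ℚ → Expr 3
        P′ = λ i x → con (P i x)
    in (Q (- 1ℚ) :- P′ zero (- 1ℚ)) :+ ((P′ (suc zero) (- ½) :- Q (- ½)) :+ (P′ (suc zero) (- ½) :- Q (- ½)))
      :+ ((Q ½ :- P′ (suc (suc zero)) ½) :+ (Q ½ :- P′ (suc (suc zero)) ½)) :+ (P′ zero 1ℚ :- Q 1ℚ)
      := con (+ 7 / 1)) refl (seq a m) (seq b m) (seq c m)

  below : ∀ i x → + 7 / 6 ≤ Q x - P i x → + 7 / 6 ≤ ∣ Q x - P i x ∣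
  below i x h = ≤-trans h (p≤∣p∣ _)

  above : ∀ i x → + 7 / 6 ≤ P i x - Q x → + 7 / 6 ≤ ∣ Q x - P i x ∣
  above i x h = ≤-trans h (≤-trans (p≤∣p∣ _) (≤-reflexive (∣p-q∣-sym (P i x) (Q x))))

  choose : _ → ∃ λ i → ∃ λ x → - 1ℚ ≤ x × x ≤ 1ℚ × + 7 / 6 ≤ ∣ Q x - P i x ∣
  choose (inj₁ (inj₁ h)) = zero             , - 1ℚ , ≤ᵇ⇒≤ _ , ≤ᵇ⇒≤ _ , below zero (- 1ℚ) h
  choose (inj₁ (inj₂ h)) = suc zero         , - ½  , ≤ᵇ⇒≤ _ , ≤ᵇ⇒≤ _ , above (suc zero) (- ½) h
  choose (inj₂ (inj₁ h)) = suc (suc zero)   , ½    , ≤ᵇ⇒≤ _ , ≤ᵇ⇒≤ _ , below (suc (suc zero)) ½ h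
  choose (inj₂ (inj₂ h)) = zero             , 1ℚ   , ≤ᵇ⇒≤ _ , ≤ᵇ⇒≤ _ , above zero 1ℚ h

lemma5p6 : ∃ λ (p : Fin 3 → Polynomial 2) →
    (∀ i j → ‖ p i -ᵖ p j ‖∞ ≤ʳ fromℚ (+ 2 / 1))
    × (∀ (q : Polynomial 2) → ∃ λ i → fromℚ (+ 109 / 100) <ʳ ‖ q -ᵖ p i ‖∞)
lemma5p6 = p
  , (λ i j → ‖‖∞-upper (p i -ᵖ p j) 2ℚ λ n x l u →
      subst (λ z → ∣ z ∣ ≤ 2ℚ) (sym (evalℚ-approx-- (p i) (p j) n x)) (p-close i j n x l u))
  , far
  where
  109/100<7/6 : + 109 / 100 < + 7 / 6
  109/100<7/6 = from-yes (+ 109 / 100 <? + 7 / 6)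

  far : ∀ q → ∃ λ i → fromℚ (+ 109 / 100) <ʳ ‖ q -ᵖ p i ‖∞
  far q =
    -- The stage `N` is fixed for all three indices first; only then does `p-far` at stage `N`
    -- select `i`, which avoids any circular dependence.
    let N , lower = eventually-∀ λ i → ‖‖∞-lower (q -ᵖ p i) 109/100<7/6
        i , x , l , u , t = p-far q N
    in i , lower N ℕ.≤-refl i x l u
         (subst (λ z → + 7 / 6 ≤ ∣ z ∣) (sym (evalℚ-approx-- q (p i) N x)) t)
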